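{- There exists an $n$-vertex graph that forces Algorithm Exh-S-kSSP (described in the context) to run for $\Omega(2^n)$ time to achieve a solution to the Single-Source Top-$k$ Simple Shortest Paths problem.
   Context: $G=(V,E,\omega)$ is a finite directed non-negatively weighted graph, $E\subseteq V\times V$, $\omega:E\to\mathbb{R}^+$ (undirected graphs are treated as having each edge in both directions, unweighted graphs as having all weights $1$); $N^+(v)=\{u\in V:(v,u)\in E\}$. A path from $s$ to $t$ is a vertex sequence $P=(s=v_1,\dots,v_\eta=t)$ with $(v_i,v_{i+1})\in E$ for all $i<\eta$; $V(P)$ is its vertex set; it is simple if it has no repeated vertex; its weight is $\omega(P)=\sum_{i=1}^{\eta-1}\omega(v_i,v_{i+1})$. For a path $\Pi$ ending at $v$ and an edge $(v,u)$, $\Pi\oplus(u)$ is $\Pi$ extended by $u$. The Single-Source Top-$k$ Simple Shortest Paths problem asks, given $G$, a root $r\in V$ and an integer $k>0$, for each $v\in V\setminus\{r\}$, for a set of pairwise distinct simple paths from $r$ to $v$ that consists of all simple $r$–$v$ paths if there are fewer than $k$ of them, and otherwise consists of exactly $k$ simple $r$–$v$ paths such that every simple $r$–$v$ path not in the set has weight at least that of every path in the set. Algorithm Exh-S-kSSP (input: $G$, $r$, $k$). Maintain a list $T_v$ for each $v\in V$ (initially empty) and a min-priority queue $PQ$ of paths keyed by weight, initially containing only the trivial path $(r)$ with key $0$. While $PQ\ne\emptyset$: remove from $PQ$ a path $\Pi=(r,\dots,v)$ of minimum weight; for each $u\in N^+(v)\setminus V(\Pi)$ insert $\Pi\oplus(u)$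 into $PQ$ with key $\omega(\Pi)+\omega(v,u)$; if $|T_v|<k$, add $\Pi$ to $T_v$. The same name is also used for the variant in which the loop additionally stops as soon as all vertices are saturated, where $v$ is saturated when $|T_v|=k$. The output is $(T_v)_{v\in V\setminus\{r\}}$. -}

module Defs where

open import Level using (0ℓ)
open import Data.Nat.Base as ℕ using (ℕ; zero; suc)
import Data.Nat.Properties as ℕ
open import Data.Rational.Base as ℚ using (ℚ; 0ℚ; ½)
import Data.Rational.Properties as ℚ
open import Data.Rational.Solver using (module +-*-Solver)
open import Data.Fin.Base using (Fin)
open import Data.Fin.Properties using (_≟_)
open import Data.List.Base using (List; []; _∷_; _++_; _∷ʳ_; length; allFin; mapMaybe)
open import Data.List.Membership.Propositional using (_∈_)
open import Data.List.Membership.DecPropositional using () renaming (_∈?_ to member?)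
open import Data.List.Relation.Unary.All using (All)
open import Data.List.Relation.Unary.Unique.Propositional using (Unique)
open import Data.Maybe.Base using (Maybe; just; nothing)
open import Data.Product.Base using (Σ; ∃; _×_; _,_; proj₁; proj₂)
open import Data.Sum.Base using (_⊎_)
open import Relation.Binary.Core using (Rel)
open import Relation.Binary.Definitions using (Decidable)
open import Relation.Binary.PropositionalEquality using (_≡_; _≢_; refl; sym; subst)
open import Relation.Nullary using (¬_; yes; no)

-- Real numbers as Cauchy sequences of rationals.  Only addition and the
-- order are needed; equality of reals is never used.

IsCauchy : (ℕ → ℚ) → Set
IsCauchy x = ∀ ε → 0ℚ ℚ.< ε →
  ∃ λ N → ∀ m n → N ℕ.≤ m → N ℕ.≤ n → ℚ.∣ x m ℚ.- x n ∣ ℚ.< ε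

record ℝ : Set where
  constructor real
  field
    seq    : ℕ → ℚ
    cauchy : IsCauchy seq
open ℝ public

infix 4 _≤ℝ_
_≤ℝ_ : Rel ℝ 0ℓ
x ≤ℝ y = ∀ ε → 0ℚ ℚ.< ε → ∃ λ N → ∀ n → N ℕ.≤ n → seq x n ℚ.≤ seq y n ℚ.+ ε

fromℚ : ℚ → ℝ
fromℚ q = real (λ _ → q) λ ε 0<ε → 0 , λ _ _ _ _ →
  subst (λ p → ℚ.∣ p ∣ ℚ.< ε) (sym (ℚ.+-inverseʳ q)) 0<ε

0ℝ : ℝ
0ℝ = fromℚ 0ℚ

private
  interchange : ∀ a b c d → (a ℚ.+ b) ℚ.- (c ℚ.+ d) ≡ (a ℚ.- c) ℚ.+ (b ℚ.- d)
  interchange = solve 4 (λ a b c d →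
    (a :+ b) :- (c :+ d) := (a :- c) :+ (b :- d)) refl
    where open +-*-Solver

  halves : ∀ ε → ½ ℚ.* ε ℚ.+ ½ ℚ.* ε ≡ ε
  halves = solve 1 (λ ε → con ½ :* ε :+ con ½ :* ε := ε) refl
    where open +-*-Solver

  half-pos : ∀ ε → 0ℚ ℚ.< ε → 0ℚ ℚ.< ½ ℚ.* ε
  half-pos ε 0<ε =
    ℚ.positive⁻¹ (½ ℚ.* ε) {{ℚ.pos*pos⇒pos ½ ε {{ℚ.positive 0<ε}}}}

  +-cauchy : ∀ {x y} → IsCauchy x → IsCauchy y → IsCauchy (λ n → x n ℚ.+ y n)
  +-cauchy {x} {y} cx cy ε 0<ε
    with cx (½ ℚ.* ε) (half-pos ε 0<ε) | cy (½ ℚ.* ε) (half-pos ε 0<ε)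
  ... | M , p | N , q = M ℕ.⊔ N , λ m n m≥ n≥ →
    subst (λ d → ℚ.∣ d ∣ ℚ.< ε) (sym (interchange (x m) (y m) (x n) (y n)))
      (ℚ.≤-<-trans (ℚ.∣p+q∣≤∣p∣+∣q∣ (x m ℚ.- x n) (y m ℚ.- y n))
        (subst (ℚ.∣ x m ℚ.- x n ∣ ℚ.+ ℚ.∣ y m ℚ.- y n ∣ ℚ.<_) (halves ε)
          (ℚ.+-mono-<
            (p m n (ℕ.m⊔n≤o⇒m≤o M N m≥) (ℕ.m⊔n≤o⇒m≤o M N n≥))
            (q m n (ℕ.m⊔n≤o⇒n≤o M N m≥) (ℕ.m⊔n≤o⇒n≤o M N n≥)))))

infixl 6 _+ℝ_
_+ℝ_ : ℝ → ℝ → ℝ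
x +ℝ y = real (λ n → seq x n ℚ.+ seq y n) (+-cauchy {seq x} {seq y} (cauchy x) (cauchy y))

-- Directed graphs with n vertices and non-negative real weights on the edges.
-- The edge proof is irrelevant in ω, so a weight depends on the pair only.

record Graph (n : ℕ) : Set₁ where
  field
    E   : Rel (Fin n) 0ℓ
    E?  : Decidable E
    ω   : ∀ v u → .(E v u) → ℝ
    0≤ω : ∀ v u → (e : E v u) → 0ℝ ≤ℝ ω v u e

module _ {n : ℕ} (G : Graph n) where
  open Graph G

  -- Edge proofs are irrelevant, so two paths are propositionally equal
  -- exactly when their vertex sequences are.
  data Path (s : Fin n) : Fin n → Set where
    trivial : Path s s
    extend  : ∀ {v} → Path s v → (u : Fin n) → .(E v u) → Path s u

module _ {n : ℕ} {G : Graph n} where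
  open Graph G

  vertices : ∀ {s v} → Path G s v → List (Fin n)
  vertices {s} trivial = s ∷ []
  vertices (extend Π u _) = vertices Π ∷ʳ u

  Simple : ∀ {s v} → Path G s v → Set
  Simple Π = Unique (vertices Π)

  weight : ∀ {s v} → Path G s v → ℝ
  weight trivial = 0ℝ
  weight (extend {v} Π u e) = weight Π +ℝ ω v u e

-- T v is the list of paths kept for v.
Lists : ∀ {n} → Graph n → Fin n → Set
Lists {n} G r = (v : Fin n) → List (Path G r v)

module _ {n : ℕ} (G : Graph n) (r : Fin n) (k : ℕ) where

  FewerThan-k-SimplePaths : Fin n → Set
  FewerThan-k-SimplePaths v =
    Σ (List (Path G r v)) λ L → length L ℕ.< k × (∀ P → Simple P → P ∈ L)

  record IsTopK (v : Fin n) (S : List (Path G r v)) : Set where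
    field
      distinct : Unique S
      simple   : All Simple S
      few      : FewerThan-k-SimplePaths v → ∀ P → Simple P → P ∈ S
      many     : ¬ FewerThan-k-SimplePaths v →
                 length S ≡ k ×
                 (∀ P → Simple P → ¬ P ∈ S → ∀ Q → Q ∈ S → weight Q ≤ℝ weight P)

  IsSolution : Lists G r → Set
  IsSolution T = ∀ v → v ≢ r → IsTopK v (T v)

-- The algorithm Exh-S-kSSP as a transition system: ties between paths of
-- minimum weight may be broken arbitrarily.

data Variant : Set where
  exhaustive stopWhenSaturated : Variant

module Exh-S-kSSP {n : ℕ} (G : Graph n) (r : Fin n) (k : ℕ) where
  open Graph G

  -- The queue is a bag of paths, in no particular order; the key of a path is
  -- its weight, as weight (extend Π u e) is by definition weight Π +ℝ ω v u e.
  Queue : Set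
  Queue = List (∃ (Path G r))

  record State : Set where
    constructor ⟨_,_⟩
    field
      queue : Queue
      lists : Lists G r
  open State public

  initial : State
  initial = ⟨ (r , trivial) ∷ [] , (λ _ → []) ⟩

  extendBy : ∀ {v} → Path G r v → Fin n → Maybe (∃ (Path G r))
  extendBy {v} Π u with E? v u | member? _≟_ u (vertices Π)
  ... | yes e | no _  = just (u , extend Π u e)
  ... | yes _ | yes _ = nothing
  ... | no _  | _     = nothing

  extensions : ∀ {v} → Path G r v → Queue
  extensions Π = mapMaybe (extendBy Π) (allFin n)

  addIfUnsaturated : ∀ {v} → Path G r v → Lists G r → Lists G r
  addIfUnsaturated {v} Π T u with v ≟ u
  ... | no _ = T u
  ... | yes refl with length (T v) ℕ.<? k
  ...   | yes _ = T v ∷ʳ Π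
  ...   | no _  = T v

  data Iteration : State → State → Set where
    iteration : ∀ {v} (Π : Path G r v) (Q₁ Q₂ : Queue) (T : Lists G r) →
      All (λ (_ , Π′) → weight Π ≤ℝ weight Π′) (Q₁ ++ Q₂) →
      Iteration ⟨ Q₁ ++ (v , Π) ∷ Q₂ , T ⟩
                ⟨ extensions Π ++ Q₁ ++ Q₂ , addIfUnsaturated Π T ⟩

  Saturated : Lists G r → Fin n → Set
  Saturated T v = length (T v) ≡ k

  Terminated : Variant → State → Set
  Terminated exhaustive        s = queue s ≡ []
  Terminated stopWhenSaturated s = queue s ≡ [] ⊎ (∀ v → Saturated (lists s) v)

  -- Run var t s : after t iterations of the main loop the state can be s.
  -- Every iteration takes at least one unit of time, so t is a lower bound on
  -- the running time.
  data Run (var : Variant) : ℕ → State → Set where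
    start : Run var 0 initial
    next  : ∀ {t s s′} → Run var t s → ¬ Terminated var s → Iteration s s′ →
            Run var (suc t) s′

-- The constant of the lower bound is 1/c: c may be taken to be an integer.
infix 4 _∈Ω_
_∈Ω_ : (ℕ → ℕ) → (ℕ → ℕ) → Set
f ∈Ω g = ∃ λ c → 0 ℕ.< c × ∃ λ n₀ → ∀ n → n₀ ℕ.≤ n → g n ℕ.≤ c ℕ.* f n

-- Each run needs at least τ iterations, both to terminate and for the lists
-- to become a solution, whatever k, the tie-breaking and the variant.
Forces : ∀ {n} → Graph n → Fin n → ℕ → Set
Forces G r τ = ∀ var k → 0 ℕ.< k → let open Exh-S-kSSP G r k in
  ∀ {t s} → Run var t s → Terminated var s ⊎ IsSolution G r k (lists s) → τ ℕ.≤ t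

{-# OPTIONS --safe #-}
-- Take the transitive tournament on {0, …, m + 1} with an edge v → u whenever
-- u < v, rooted at m + 1, where the edges into 0 weigh 1 and all others weigh 0.
-- Paths that end outside 0 weigh 0, so all 2 ^ m of them leave the queue before
-- the first path to 0 does.  They are counted by a potential: a path ending at
-- j + 1 has 2 ^ j extensions (itself included) that avoid 0, and removing it
-- while inserting its one-step extensions lowers the total over the queue by
-- exactly 1.  Until the potential is exhausted, the list of the vertex 0 is
-- empty, so the algorithm can neither have terminated nor have found a solution.
module Submission where

open import Defs
open import Data.Nat.Base using (ℕ; _≤_; _^_)
open import Data.Fin.Base using (Fin)
open import Data.Product.Base using (Σ; _×_)

open import Data.Nat.Base using (zero; suc; _+_; _<_; _<ᵇ_; z≤n; s≤s)
import Data.Nat.Properties as ℕ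
open import Data.Bool.Base using (true; false; if_then_else_)
open import Data.Empty using (⊥-elim)
open import Data.Fin.Base using (zero; suc; toℕ; fromℕ)
import Data.Fin.Base as Fin
import Data.Fin.Properties as Fin
open import Data.List.Base using (List; []; _∷_; _++_; length; map; mapMaybe; tabulate; allFin)
open import Data.List.Membership.DecPropositional using () renaming (_∈?_ to member?)
open import Data.List.Properties using (map-++; map-tabulate)
open import Data.List.Relation.Unary.All as All using (All; []; _∷_)
open import Data.List.Relation.Unary.All.Properties using (∷ʳ⁺)
open import Data.List.Relation.Unary.AllPairs using ([]; _∷_)
open import Data.Nat.ListAction using (sum)
open import Data.Nat.ListAction.Properties using (sum-++)
open import Data.Product.Base using (∃; _,_; proj₁; proj₂)
open import Data.Rational.Base as ℚ using (ℚ; 0ℚ; 1ℚ; ½)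
import Data.Rational.Properties as ℚ
open import Data.Sum.Base using (_⊎_; inj₁; inj₂)
open import Algebra.Properties.CommutativeSemigroup ℕ.+-commutativeSemigroup using (x∙yz≈y∙xz)
open import Function.Base using (_∘_; case_of_)
open import Relation.Binary.PropositionalEquality using (_≡_; refl; sym; trans; cong; cong₂; subst; module ≡-Reasoning)
open import Relation.Nullary using (¬_; yes; no; contradiction)
open import Relation.Nullary.Decidable using (from-yes; from-no; recompute)

entryCost : ∀ {n} → Fin n → ℚ
entryCost zero    = 1ℚ
entryCost (suc _) = 0ℚ

0≤entryCost : ∀ {n} (u : Fin n) → 0ℚ ℚ.≤ entryCost u
0≤entryCost zero    = from-yes (0ℚ ℚ.≤? 1ℚ)
0≤entryCost (suc _) = ℚ.≤-refl

fromℚ-mono-≤ : ∀ {p q} → p ℚ.≤ q → fromℚ p ≤ℝ fromℚ q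
fromℚ-mono-≤ {p} {q} p≤q ε 0<ε = 0 , λ _ _ →
  ℚ.≤-trans p≤q (subst (ℚ._≤ q ℚ.+ ε) (ℚ.+-identityʳ q) (ℚ.+-monoʳ-≤ q (ℚ.<⇒≤ 0<ε)))

tournament : ∀ n → Graph n
tournament n = record
  { E   = λ v u → u Fin.< v
  ; E?  = λ v u → u Fin.<? v
  ; ω   = λ _ u _ → fromℚ (entryCost u)
  ; 0≤ω = λ _ u _ → fromℚ-mono-≤ (0≤entryCost u)
  }

-- Vertex 0 has no outgoing edges, so only the last step of a path can cost anything.
seq-weight : ∀ {n} {r : Fin n} {v} (P : Path (tournament (suc n)) (suc r) v) i →
             seq (weight P) i ≡ entryCost v
seq-weight trivial i = refl
seq-weight (extend {suc v} P u _) i =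
  trans (cong (ℚ._+ entryCost u) (seq-weight P i)) (ℚ.+-identityˡ (entryCost u))
seq-weight (extend {zero} P u ())

heavy≰light : ∀ {n} {r v : Fin n} (P : Path (tournament (suc n)) (suc r) zero)
              (Q : Path (tournament (suc n)) (suc r) (suc v)) → ¬ weight P ≤ℝ weight Q
-- The two weights are the constants 1 and 0, which the tolerance `½` separates.
heavy≰light P Q P≤Q with P≤Q ½ (ℚ.positive⁻¹ ½)
... | N , P≤Q+½ with P≤Q+½ N ℕ.≤-refl
...   | 1≤½ rewrite seq-weight P N | seq-weight Q N = from-no (1ℚ ℚ.≤? 0ℚ ℚ.+ ½) 1≤½

-- Edges lead to smaller vertices, so an out-neighbour of the end is never on the path: the
-- membership test in `extendBy` rejects no edge.
end≤vertices : ∀ {n} {r v : Fin n} (P : Path (tournament n) r v) → All (v Fin.≤_) (vertices P)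
end≤vertices trivial = ℕ.≤-refl ∷ []
end≤vertices (extend {v} P u u<v) =
  ∷ʳ⁺ (All.map (ℕ.≤-trans (ℕ.<⇒≤ (recompute (u Fin.<? v) u<v))) (end≤vertices P)) ℕ.≤-refl

potential : ∀ {n} → Fin n → ℕ
potential zero    = 0
potential (suc j) = 2 ^ toℕ j

queuePotential : ∀ {n} {r : Fin n} → List (∃ (Path (tournament n) r)) → ℕ
queuePotential Q = sum (map (potential ∘ proj₁) Q)

queuePotential-++ : ∀ {n} {r : Fin n} (P Q : List (∃ (Path (tournament n) r))) →
                    queuePotential (P ++ Q) ≡ queuePotential P + queuePotential Q
queuePotential-++ P Q =
  trans (cong sum (map-++ (potential ∘ proj₁) P Q)) (sum-++ (map (potential ∘ proj₁) P) _)

-- A path ending outside 0 would be lighter than `P`, so `Q` holds only paths to 0, each of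
-- potential 0.
heavy-minimal⇒potential≡0 : ∀ {n} {r : Fin n} (P : Path (tournament (suc n)) (suc r) zero)
  (Q : List (∃ (Path (tournament (suc n)) (suc r)))) →
  All (λ (_ , P′) → weight P ≤ℝ weight P′) Q → queuePotential Q ≡ 0
heavy-minimal⇒potential≡0 P [] [] = refl
heavy-minimal⇒potential≡0 P ((zero , _) ∷ Q) (_ ∷ P≤) = heavy-minimal⇒potential≡0 P Q P≤
heavy-minimal⇒potential≡0 P ((suc _ , P′) ∷ Q) (P≤P′ ∷ _) = ⊥-elim (heavy≰light P P′ P≤P′)

-- For `h = 2 ^_` this is `1 + (1 + 2 + … + 2 ^ (a - 1)) = 2 ^ a`. The first summand merges with
-- `h 0` into `h 1`, and the induction goes on with `h ∘ suc`; hence the general `h`.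
sum-doubling : ∀ (h : ℕ → ℕ) → (∀ j → h (suc j) ≡ h j + h j) → ∀ {a} n → a ≤ n →
               h 0 + sum (tabulate {n = n} λ u → if toℕ u <ᵇ a then h (toℕ u) else 0) ≡ h a
sum-doubling h double {zero} zero a≤n = ℕ.+-identityʳ (h 0)
sum-doubling h double {zero} (suc n) a≤n = sum-doubling h double n z≤n
sum-doubling h double {suc a} (suc n) (s≤s a≤n) = begin
  h 0 + (h 0 + rest) ≡⟨ ℕ.+-assoc (h 0) (h 0) rest ⟨
  h 0 + h 0 + rest   ≡⟨ cong (_+ rest) (double 0) ⟨
  h 1 + rest         ≡⟨ sum-doubling (h ∘ suc) (double ∘ suc) n a≤n ⟩
  h (suc a)          ∎
  where
  open ≡-Reasoning
  rest = sum (tabulate {n = n} λ u → if toℕ u <ᵇ a then h (suc (toℕ u)) else 0)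

sum-potential : ∀ {n} (v : Fin n) →
  suc (sum (map (λ u → if toℕ u <ᵇ suc (toℕ v) then potential u else 0) (allFin (suc n))))
    ≡ potential (suc v)
sum-potential {n} v = trans
  -- Vertex 0 contributes 0, which leaves the vertices `suc u`, of potential `2 ^ toℕ u`.
  (cong (suc ∘ sum) (map-tabulate {n = n} suc (λ u → if toℕ u <ᵇ suc (toℕ v) then potential u else 0)))
  (sum-doubling (2 ^_) (λ j → cong (2 ^ j +_) (ℕ.+-identityʳ (2 ^ j))) n (ℕ.<⇒≤ (Fin.toℕ<n v)))

module _ {m : ℕ} where

  G : Graph (suc (suc m))
  G = tournament (suc (suc m))

  root : Fin (suc (suc m))
  root = fromℕ (suc m)

  module _ (k : ℕ) where
    open Exh-S-kSSP G root k

    potential-extendBy : ∀ {v} (P : Path G root v) us →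
      queuePotential (mapMaybe (extendBy P) us)
        ≡ sum (map (λ u → if toℕ u <ᵇ toℕ v then potential u else 0) us)
    potential-extendBy P [] = refl
    potential-extendBy {v} P (u ∷ us) with u Fin.<? v | member? Fin._≟_ u (vertices P)
    ... | yes u<v | yes u∈P = contradiction (All.lookup (end≤vertices P) u∈P) (ℕ.<⇒≱ u<v)
    ... | yes u<v | no _  with toℕ u <ᵇ toℕ v | ℕ.<⇒<ᵇ u<v
    ...   | true | _ = cong (potential u +_) (potential-extendBy P us)
    potential-extendBy {v} P (u ∷ us) | no u≮v | _
      with toℕ u <ᵇ toℕ v | ℕ.<ᵇ⇒< (toℕ u) (toℕ v)
    ...   | true  | u<v = contradiction (u<v _) u≮v
    ...   | false | _   = potential-extendBy P us

    potential-extensions : ∀ {v} (P : Path G root (suc v)) →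
                           suc (queuePotential (extensions P)) ≡ potential (suc v)
    potential-extensions {v} P =
      trans (cong suc (potential-extendBy P (allFin _))) (sum-potential v)

    potential-iteration : ∀ {v} (P : Path G root (suc v)) Q₁ Q₂ →
      queuePotential (Q₁ ++ (suc v , P) ∷ Q₂) ≡ suc (queuePotential (extensions P ++ Q₁ ++ Q₂))
    potential-iteration {v} P Q₁ Q₂ = begin
      queuePotential (Q₁ ++ (suc v , P) ∷ Q₂)        ≡⟨ queuePotential-++ Q₁ _ ⟩
      q₁ + (potential (suc v) + q₂)                  ≡⟨ x∙yz≈y∙xz q₁ (potential (suc v)) q₂ ⟩
      potential (suc v) + (q₁ + q₂)                  ≡⟨ cong₂ _+_ (potential-extensions P) (queuePotential-++ Q₁ Q₂) ⟨
      suc (queuePotential (extensions P) + queuePotential (Q₁ ++ Q₂))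
                                                     ≡⟨ cong suc (queuePotential-++ (extensions P) _) ⟨
      suc (queuePotential (extensions P ++ Q₁ ++ Q₂)) ∎
      where
      open ≡-Reasoning
      q₁ = queuePotential Q₁
      q₂ = queuePotential Q₂

    -- Remaining potential and elapsed time add up to `2 ^ m` until a path to 0 is removed. By then
    -- the potential is 0, so the bound on `t` holds and nothing more has to be tracked.
    Invariant : ℕ → State → Set
    Invariant t s = 2 ^ m ≤ t ⊎ (2 ^ m ≡ queuePotential (queue s) + t × lists s zero ≡ [])

    invariant-step : ∀ {t s s′} → Iteration s s′ → Invariant t s → Invariant (suc t) s′
    invariant-step _ (inj₁ 2^m≤t) = inj₁ (ℕ.m≤n⇒m≤1+n 2^m≤t)
    invariant-step {t} (iteration {zero} P Q₁ Q₂ T minimal) (inj₂ (2^m≡ , _)) =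
      inj₁ (ℕ.m≤n⇒m≤1+n (ℕ.≤-reflexive (trans 2^m≡ (cong (_+ t) exhausted))))
      where
      exhausted : queuePotential (Q₁ ++ (zero , P) ∷ Q₂) ≡ 0
      exhausted = trans (queuePotential-++ Q₁ _)
        (trans (sym (queuePotential-++ Q₁ Q₂)) (heavy-minimal⇒potential≡0 P (Q₁ ++ Q₂) minimal))
    -- The removed path ends outside 0, so the list of 0 stays as it is, and the lost unit of
    -- potential pays for the iteration.
    invariant-step {t} (iteration {suc v} P Q₁ Q₂ T _) (inj₂ (2^m≡ , T₀≡[])) =
      inj₂ (trans 2^m≡ (trans (cong (_+ t) (potential-iteration P Q₁ Q₂)) (sym (ℕ.+-suc _ t))) , T₀≡[])

    invariant : ∀ {var t s} → Run var t s → Invariant t s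
    -- The trivial path ends at vertex `m + 1`, of potential `2 ^ m`.
    invariant start = inj₂ (sym (trans (ℕ.+-identityʳ _) (trans (ℕ.+-identityʳ _) (cong (2 ^_) (Fin.toℕ-fromℕ m)))) , refl)
    invariant (next run _ it) = invariant-step it (invariant run)

    -- The edge from the root to 0 is a simple path missing from `[]`, which rules out the case of
    -- `few`; the case of `many` would make `k` zero.
    []-not-topK : 0 < k → ¬ IsTopK G root k zero []
    []-not-topK 0<k topK = ℕ.<⇒≢ 0<k (proj₁ (many λ fewer → case few fewer direct direct-simple of λ ()))
      where
      open IsTopK topK
      direct : Path G root zero
      direct = extend trivial zero (s≤s z≤n)
      direct-simple : Simple direct
      direct-simple = ((λ ()) ∷ []) ∷ [] ∷ []

  tournament-forces : Forces G root (2 ^ m)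
  tournament-forces var k 0<k {t} {s} run done with invariant k run
  ... | inj₁ 2^m≤t = 2^m≤t
  ... | inj₂ (2^m≡ , T₀≡[]) = conclude var done
    where
    open Exh-S-kSSP G root k

    emptyQueue : queue s ≡ [] → 2 ^ m ≤ t
    emptyQueue q≡[] = ℕ.≤-reflexive (trans 2^m≡ (cong (λ q → queuePotential q + t) q≡[]))

    conclude : ∀ var → Terminated var s ⊎ IsSolution G root k (lists s) → 2 ^ m ≤ t
    conclude exhaustive (inj₁ q≡[]) = emptyQueue q≡[]
    conclude stopWhenSaturated (inj₁ (inj₁ q≡[])) = emptyQueue q≡[]
    conclude stopWhenSaturated (inj₁ (inj₂ saturated)) =
      contradiction (trans (cong length (sym T₀≡[])) (saturated zero)) (ℕ.<⇒≢ 0<k)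
    conclude _ (inj₂ solution) =
      contradiction (subst (IsTopK G root k zero) T₀≡[] (solution zero λ ())) ([]-not-topK k 0<k)

-- With a single vertex the initial empty lists already solve the problem.
iterations : ℕ → ℕ
iterations (suc (suc m)) = 2 ^ m
iterations _             = 0

iterations∈Ω : iterations ∈Ω (2 ^_)
-- `2 ^ (m + 2)` is `4 * 2 ^ m`, and the exponential bound starts at two vertices.
iterations∈Ω = 4 , s≤s z≤n , 2 , λ where
  (suc (suc m)) (s≤s (s≤s z≤n)) → ℕ.≤-reflexive (sym (ℕ.*-assoc 2 2 (2 ^ m)))

theorem2 : Σ (ℕ → ℕ) λ τ → (τ ∈Ω (2 ^_)) × (∀ n → 1 ≤ n → Σ (Graph n) λ G → Σ (Fin n) λ r → Forces G r (τ n))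
theorem2 = iterations , iterations∈Ω , λ where
  1             _ → tournament 1 , zero , λ _ _ _ _ _ → z≤n
  (suc (suc m)) _ → G , root , tournament-forces
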